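{- If $\phi\in\mathcal{L}_{\mathsf{TDS}}$ is a consistent formula (i.e. $\{\phi\}\not\vdash_{\mathsf{TDS}}\bot$), then $\phi$ is satisfiable on a $\mathsf{TDS}$-model, i.e. there are a $\mathsf{TDS}$-model $M$ and a world $w$ of $M$ with $M,w\models\phi$.
   Context: **Language.** Let $Ag=\{1,2,\dots,n\}$ be a finite set of agent labels and $Var=\{p_1,p_2,p_3,\dots\}$ a countable set of propositional variables. $\mathcal{L}_{\mathsf{TDS}}$ is given by $\phi ::= p \mid \neg\phi \mid \phi\land\phi \mid \Box\phi \mid [i]\phi \mid [Ag]\phi \mid \mathsf{G}\phi \mid \mathsf{H}\phi \mid \otimes_i\phi$ with $i\in Ag$, $p\in Var$. $\lor,\rightarrow,\leftrightarrow,\bot,\top$ are defined as usual. Duals: $\Diamond:=\neg\Box\neg$, $\langle i\rangle:=\neg[i]\neg$, $\langle Ag\rangle:=\neg[Ag]\neg$, $\ominus_i:=\neg\otimes_i\neg$, $\mathsf{F}:=\neg\mathsf{G}\neg$, $\mathsf{P}:=\neg\mathsf{H}\neg$. **$\mathsf{TDS}$-frames.** A $\mathsf{TDS}$-frame is a tuple $F=(W,R_\Box,\{R_{[i]}\}_{i\in Ag},R_{[Ag]},R_{\mathsf G},R_{\mathsf H},\{R_{\otimes_i}\}_{i\in Ag})$ with $W$ a non-empty set and all relations binary on $W$; write $R(w)=\{v\in W: (w,v)\in R\}$ for a relation $R$. It is required that: - $R_\Box$, all $R_{[i]}$, and $R_{[Ag]}$ are equivalence relations, and for all $i\in Ag$: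 (C1) $R_{[i]}\subseteq R_\Box$; (C2) for all $u_1,\dots,u_n\in W$, if $R_\Box u_iu_j$ for all $1\le i,j\le n$, then $\bigcap_{i}R_{[i]}(u_i)\neq\emptyset$; (C3) for all $w$, $R_{[Ag]}(w)\subseteq\bigcap_{i\in Ag}R_{[i]}(w)$. - $R_{\mathsf G}$ is transitive and serial, $R_{\mathsf H}$ is the converse of $R_{\mathsf G}$, and: (T4) if $R_{\mathsf G}wu$ and $R_{\mathsf G}wv$ then $R_{\mathsf G}uv$, $u=v$, or $R_{\mathsf G}vu$; (T5) if $R_{\mathsf H}wu$ and $R_{\mathsf H}wv$ then $R_{\mathsf H}uv$, $u=v$, or $R_{\mathsf H}vu$; (T6) $R_{\mathsf G}\circ R_\Box\subseteq R_{[Ag]}\circ R_{\mathsf G}$, i.e. if $R_{\mathsf G}wu$ and $R_\Box uv$ then there is $x$ with $R_{[Ag]}wx$ and $R_{\mathsf G}xv$; (T7) if $u\in R_\Box(w)$ then $u\notin R_{\mathsf G}(w)$. - For all $i\in Ag$: (D8) $R_{\otimes_i}\subseteq R_\Box$; (D9) for all $w$ there is $v$ with $R_\Box wv$ such that for all $u$, $R_{[i]}vu$ implies $R_{\otimes_i}wu$; (D10) for all $w,v,u,z$, if $R_\Box wv$, $R_\Box wu$ and $R_{\otimes_i}uz$, then $R_{\otimes_i}vz$; (D11) for all $w,v$, if $R_{\otimes_i}wv$ then there is $u$ with $R_\Box wu$, $R_{[i]}uv$, and for all $z$, $R_{[i]}uz$ implies $R_{\otimes_i}wz$. A $\mathsf{TDS}$-model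 is $M=(F,V)$ with $F$ a $\mathsf{TDS}$-frame and $V:Var\to\mathcal{P}(W)$. **Satisfaction.** $M,w\models p$ iff $w\in V(p)$; Boolean clauses as usual; each of $\Box,[i],[Ag],\mathsf G,\mathsf H,\otimes_i$ is the universal modality of the relation $R_\Box,R_{[i]},R_{[Ag]},R_{\mathsf G},R_{\mathsf H},R_{\otimes_i}$ respectively (e.g. $M,w\models\otimes_i\phi$ iff $M,u\models\phi$ for all $u\in R_{\otimes_i}(w)$). **Axiom system $\mathsf{TDS}$** (for all formulae $\phi,\psi,\phi_1,\dots,\phi_n$ and each $i\in Ag$): A0 all propositional tautologies; A1 $\Box(\phi\to\psi)\to(\Box\phi\to\Box\psi)$; A2 $\Box\phi\to\phi$; A3 $\Diamond\phi\to\Box\Diamond\phi$; A4 $[i](\phi\to\psi)\to([i]\phi\to[i]\psi)$; A5 $[i]\phi\to\phi$; A6 $\langle i\rangle\phi\to[i]\langle i\rangle\phi$; A7 $[Ag](\phi\to\psi)\to([Ag]\phi\to[Ag]\psi)$; A8 $[Ag]\phi\to\phi$; A9 $\langle Ag\rangle\phi\to[Ag]\langle Ag\rangle\phi$; A10 $\bigwedge_{1\le i\le n}\Diamond[i]\phi_i\to\Diamond\bigwedge_{1\le i\le n}[i]\phi_i$; A11 $\bigwedge_{1\le i\le n}[i]\phi_i\to[Ag]\bigwedge_{1\le i\le n}\phi_i$; A12 $\otimes_i(\phi\to\psi)\to(\otimes_i\phi\to\otimes_i\psi)$; A13 $\Box\phi\to([i]\phi\land\otimes_i\phi)$; A14 $\otimes_i\phi\to\Diamond[i]\phi$;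 A15 $\Diamond\otimes_i\phi\to\Box\otimes_i\phi$; A16 $\Box([i]\phi\to[i]\psi)\to(\otimes_i\phi\to\otimes_i\psi)$; A17 $\mathsf G(\phi\to\psi)\to(\mathsf G\phi\to\mathsf G\psi)$; A18 $\mathsf G\phi\to\mathsf G\mathsf G\phi$; A19 $\mathsf G\phi\to\mathsf F\phi$; A20 $\mathsf H(\phi\to\psi)\to(\mathsf H\phi\to\mathsf H\psi)$; A21 $\phi\to\mathsf G\mathsf P\phi$; A22 $\phi\to\mathsf H\mathsf F\phi$; A23 $\mathsf F\mathsf P\phi\to\mathsf P\phi\lor\phi\lor\mathsf F\phi$; A24 $\mathsf P\mathsf F\phi\to\mathsf P\phi\lor\phi\lor\mathsf F\phi$; A25 $\mathsf F\Diamond\phi\to\langle Ag\rangle\mathsf F\phi$. Rules: R0 from $\vdash\psi\to\phi$ and $\vdash\psi$ infer $\vdash\phi$; R1 from $\vdash\phi$ infer $\vdash[\alpha]\phi$ for $[\alpha]\in\{\Box,\mathsf G,\mathsf H\}$; R2 from $\vdash(\Box\neg p\land\Box(\mathsf Gp\land\mathsf Hp))\to\phi$ infer $\vdash\phi$, where $p\in Var$ does not occur in $\phi$. $\vdash_{\mathsf{TDS}}\phi$ means $\phi$ is derivable from these axioms and rules; $\Gamma\vdash_{\mathsf{TDS}}\phi$ means $\vdash_{\mathsf{TDS}}\phi$ or there are $\psi_1,\dots,\psi_m\in\Gamma$ with $\vdash_{\mathsf{TDS}}(\psi_1\land\dots\land\psi_m)\to\phi$.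
   Formalization: In A10 and A11 the conjunction over i writes repeated conjuncts only once, which makes necessitation for [Ag] derivable; with literal n-fold conjunctions and n ≥ 2, ¬[Ag](p→p) would be consistent but unsatisfiable. -}

module Defs where

open import Data.Bool using (Bool; true; not) renaming (_∧_ to _and_)
open import Data.Fin using (Fin)
import Data.Fin.Properties as Fin
open import Data.List using (List; []; _∷_; deduplicate; tabulate)
open import Data.List.Relation.Unary.All using (All)
open import Data.Nat using (ℕ)
import Data.Nat.Properties as ℕ
open import Data.Product using (∃-syntax; Σ-syntax; _×_; _,_)
open import Data.Sum using (_⊎_)
open import Function using (_⇔_)
open import Level using (0ℓ) renaming (suc to lsuc)
open import Relation.Binary using (Rel; IsEquivalence; Transitive; DecidableEquality)
open import Relation.Binary.PropositionalEquality using (_≡_; refl; cong; cong₂)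
open import Relation.Nullary using (yes; no) renaming (¬_ to Not)
open import Relation.Nullary.Decidable using (map′; _×-dec_)
open import Relation.Unary using (Pred; ｛_｝)

Var : Set
Var = ℕ

-- n is the number of agents, Fin n the set Ag.

data Modality (n : ℕ) : Set where
  box        : Modality n
  agent      : Fin n → Modality n
  grand      : Modality n
  always     : Modality n
  hasAlways  : Modality n
  ought      : Fin n → Modality n

infix  30 ¬_ □_ ◇_ [_]_ ⟨_⟩_ [Ag]_ ⟨Ag⟩_ G_ H_ F_ P_ ⊗[_]_
infixr 25 _∧_
infixr 24 _∨_
infixr 20 _⇒_

data Form (n : ℕ) : Set where
  var   : Var → Form n
  ¬_    : Form n → Form n
  _∧_   : Form n → Form n → Form n
  modal : Modality n → Form n → Form n

pattern □_ φ      = modal box φ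
pattern [_]_ i φ  = modal (agent i) φ
pattern [Ag]_ φ   = modal grand φ
pattern G_ φ      = modal always φ
pattern H_ φ      = modal hasAlways φ
pattern ⊗[_]_ i φ = modal (ought i) φ

private variable
  n : ℕ

_∨_ _⇒_ : Form n → Form n → Form n
φ ∨ ψ = ¬ (¬ φ ∧ ¬ ψ)
φ ⇒ ψ = ¬ (φ ∧ ¬ ψ)

⊥ ⊤ : Form n
⊥ = var 0 ∧ ¬ var 0
⊤ = ¬ ⊥

◇_ ⟨Ag⟩_ F_ P_ : Form n → Form n
◇ φ    = ¬ □ ¬ φ
⟨Ag⟩ φ = ¬ [Ag] ¬ φ
F φ    = ¬ G ¬ φ
P φ    = ¬ H ¬ φ

⟨_⟩_ : Fin n → Form n → Form n
⟨ i ⟩ φ = ¬ [ i ] ¬ φ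

_≟ᵐ_ : DecidableEquality (Modality n)
box       ≟ᵐ box       = yes refl
box       ≟ᵐ agent _   = no λ ()
box       ≟ᵐ grand     = no λ ()
box       ≟ᵐ always    = no λ ()
box       ≟ᵐ hasAlways = no λ ()
box       ≟ᵐ ought _   = no λ ()
agent _   ≟ᵐ box       = no λ ()
agent i   ≟ᵐ agent j   = map′ (cong agent) (λ { refl → refl }) (i Fin.≟ j)
agent _   ≟ᵐ grand     = no λ ()
agent _   ≟ᵐ always    = no λ ()
agent _   ≟ᵐ hasAlways = no λ ()
agent _   ≟ᵐ ought _   = no λ ()
grand     ≟ᵐ box       = no λ ()
grand     ≟ᵐ agent _   = no λ ()
grand     ≟ᵐ grand     = yes refl
grand     ≟ᵐ always    = no λ ()
grand     ≟ᵐ hasAlways = no λ ()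
grand     ≟ᵐ ought _   = no λ ()
always    ≟ᵐ box       = no λ ()
always    ≟ᵐ agent _   = no λ ()
always    ≟ᵐ grand     = no λ ()
always    ≟ᵐ always    = yes refl
always    ≟ᵐ hasAlways = no λ ()
always    ≟ᵐ ought _   = no λ ()
hasAlways ≟ᵐ box       = no λ ()
hasAlways ≟ᵐ agent _   = no λ ()
hasAlways ≟ᵐ grand     = no λ ()
hasAlways ≟ᵐ always    = no λ ()
hasAlways ≟ᵐ hasAlways = yes refl
hasAlways ≟ᵐ ought _   = no λ ()
ought _   ≟ᵐ box       = no λ ()
ought _   ≟ᵐ agent _   = no λ ()
ought _   ≟ᵐ grand     = no λ ()
ought _   ≟ᵐ always    = no λ ()
ought _   ≟ᵐ hasAlways = no λ ()
ought i   ≟ᵐ ought j   = map′ (cong ought) (λ { refl → refl }) (i Fin.≟ j)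

_≟_ : DecidableEquality (Form n)
var p     ≟ var q      = map′ (cong var) (λ { refl → refl }) (p ℕ.≟ q)
var _     ≟ (¬ _)      = no λ ()
var _     ≟ (_ ∧ _)    = no λ ()
var _     ≟ modal _ _  = no λ ()
(¬ _)     ≟ var _      = no λ ()
(¬ φ)     ≟ (¬ ψ)      = map′ (cong ¬_) (λ { refl → refl }) (φ ≟ ψ)
(¬ _)     ≟ (_ ∧ _)    = no λ ()
(¬ _)     ≟ modal _ _  = no λ ()
(_ ∧ _)   ≟ var _      = no λ ()
(_ ∧ _)   ≟ (¬ _)      = no λ ()
(φ ∧ ψ)   ≟ (φ′ ∧ ψ′)  = map′ (λ (p , q) → cong₂ _∧_ p q) (λ { refl → refl , refl })
                              (φ ≟ φ′ ×-dec ψ ≟ ψ′)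
(_ ∧ _)   ≟ modal _ _  = no λ ()
modal _ _ ≟ var _      = no λ ()
modal _ _ ≟ (¬ _)      = no λ ()
modal _ _ ≟ (_ ∧ _)    = no λ ()
modal m φ ≟ modal m′ ψ = map′ (λ (p , q) → cong₂ modal p q) (λ { refl → refl , refl })
                              (m ≟ᵐ m′ ×-dec φ ≟ ψ)

conj : List (Form n) → Form n
conj []           = ⊤
conj (φ ∷ [])     = φ
conj (φ ∷ ψ ∷ φs) = φ ∧ conj (ψ ∷ φs)

-- ⋀ φ is the conjunction of the finite *set* { φ i }: a formula occurring
-- several times among the φ i is written once, so ⋀ of a constant family φ is
-- φ itself.  This matters in the axiom `indep` below, whose instance at a
-- constant family is then ⋀ᵢ [i]φ ⇒ [Ag]φ; it makes the rule "from ⊢ φ infer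
-- ⊢ [Ag]φ" derivable.  If the conclusion of `indep` were always the n-fold
-- conjunction [Ag](φ ∧ … ∧ φ), then for n ≥ 2 valid formulas such as [Ag](p ⇒ p)
-- would be underivable: read [Ag]χ as "χ has the form _∧_ or ⟨Ag⟩_, and χ holds
-- at all R[Ag]-successors".
⋀ : (Fin n → Form n) → Form n
⋀ φ = conj (deduplicate _≟_ (tabulate φ))

Occurs : Var → Form n → Set
Occurs p (var q)     = p ≡ q
Occurs p (¬ φ)       = Occurs p φ
Occurs p (φ ∧ ψ)     = Occurs p φ ⊎ Occurs p ψ
Occurs p (modal m φ) = Occurs p φ

-- Formulas whose main operator is modal count as propositional atoms.
eval : (Form n → Bool) → Form n → Bool
eval v (¬ φ)   = not (eval v φ)
eval v (φ ∧ ψ) = eval v φ and eval v ψ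
eval v φ       = v φ

Tautology : Form n → Set
Tautology φ = ∀ v → eval v φ ≡ true

infix 10 ⊢_ _⊢_

data ⊢_ {n : ℕ} : Form n → Set where
  taut    : ∀ {φ} → Tautology φ → ⊢ φ

  K-□     : ∀ {φ ψ} → ⊢ □ (φ ⇒ ψ) ⇒ □ φ ⇒ □ ψ
  T-□     : ∀ {φ} → ⊢ □ φ ⇒ φ
  5-□     : ∀ {φ} → ⊢ ◇ φ ⇒ □ ◇ φ

  K-[]    : ∀ {i φ ψ} → ⊢ [ i ] (φ ⇒ ψ) ⇒ [ i ] φ ⇒ [ i ] ψ
  T-[]    : ∀ {i φ} → ⊢ [ i ] φ ⇒ φ
  5-[]    : ∀ {i φ} → ⊢ ⟨ i ⟩ φ ⇒ [ i ] ⟨ i ⟩ φ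

  K-Ag    : ∀ {φ ψ} → ⊢ [Ag] (φ ⇒ ψ) ⇒ [Ag] φ ⇒ [Ag] ψ
  T-Ag    : ∀ {φ} → ⊢ [Ag] φ ⇒ φ
  5-Ag    : ∀ {φ} → ⊢ ⟨Ag⟩ φ ⇒ [Ag] ⟨Ag⟩ φ

  ioa     : ∀ {φ : Fin n → Form n} → ⊢ ⋀ (λ i → ◇ [ i ] φ i) ⇒ ◇ ⋀ (λ i → [ i ] φ i)
  indep   : ∀ {φ : Fin n → Form n} → ⊢ ⋀ (λ i → [ i ] φ i) ⇒ [Ag] ⋀ φ

  K-⊗     : ∀ {i φ ψ} → ⊢ ⊗[ i ] (φ ⇒ ψ) ⇒ ⊗[ i ] φ ⇒ ⊗[ i ] ψ
  □⇒[]∧⊗  : ∀ {i φ} → ⊢ □ φ ⇒ [ i ] φ ∧ ⊗[ i ] φ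
  ⊗⇒◇[]   : ∀ {i φ} → ⊢ ⊗[ i ] φ ⇒ ◇ [ i ] φ
  ◇⊗⇒□⊗   : ∀ {i φ} → ⊢ ◇ ⊗[ i ] φ ⇒ □ ⊗[ i ] φ
  ⊗-mono  : ∀ {i φ ψ} → ⊢ □ ([ i ] φ ⇒ [ i ] ψ) ⇒ ⊗[ i ] φ ⇒ ⊗[ i ] ψ

  K-G     : ∀ {φ ψ} → ⊢ G (φ ⇒ ψ) ⇒ G φ ⇒ G ψ
  4-G     : ∀ {φ} → ⊢ G φ ⇒ G G φ
  D-G     : ∀ {φ} → ⊢ G φ ⇒ F φ
  K-H     : ∀ {φ ψ} → ⊢ H (φ ⇒ ψ) ⇒ H φ ⇒ H ψ
  conv-GP : ∀ {φ} → ⊢ φ ⇒ G P φ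
  conv-HF : ∀ {φ} → ⊢ φ ⇒ H F φ
  lin-FP  : ∀ {φ} → ⊢ F P φ ⇒ P φ ∨ φ ∨ F φ
  lin-PF  : ∀ {φ} → ⊢ P F φ ⇒ P φ ∨ φ ∨ F φ
  F◇⇒AgF  : ∀ {φ} → ⊢ F ◇ φ ⇒ ⟨Ag⟩ F φ

  mp      : ∀ {φ ψ} → ⊢ ψ ⇒ φ → ⊢ ψ → ⊢ φ
  nec-□   : ∀ {φ} → ⊢ φ → ⊢ □ φ
  nec-G   : ∀ {φ} → ⊢ φ → ⊢ G φ
  nec-H   : ∀ {φ} → ⊢ φ → ⊢ H φ
  irr     : ∀ {p φ} → Not (Occurs p φ) →
            ⊢ □ ¬ var p ∧ □ (G var p ∧ H var p) ⇒ φ → ⊢ φ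

_⊢_ : Pred (Form n) 0ℓ → Form n → Set
Γ ⊢ φ = (⊢ φ) ⊎ (∃[ ψs ] All Γ ψs × (⊢ conj ψs ⇒ φ))

Consistent : Form n → Set
Consistent φ = Not (｛ φ ｝ ⊢ ⊥)

record Frame (n : ℕ) : Set (lsuc 0ℓ) where
  field
    W        : Set
    nonempty : W

    R□          : Rel W 0ℓ
    R[_]        : Fin n → Rel W 0ℓ
    RAg         : Rel W 0ℓ
    RG RH       : Rel W 0ℓ
    R⊗[_]       : Fin n → Rel W 0ℓ

    □-equiv  : IsEquivalence R□
    []-equiv : ∀ i → IsEquivalence R[ i ]
    Ag-equiv : IsEquivalence RAg
    C1 : ∀ {i w v} → R[ i ] w v → R□ w v
    C2 : (u : Fin n → W) → (∀ i j → R□ (u i) (u j)) → ∃[ v ] ∀ i → R[ i ] (u i) v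
    C3 : ∀ {w v} → RAg w v → ∀ i → R[ i ] w v

    G-trans  : Transitive RG
    G-serial : ∀ w → ∃[ v ] RG w v
    H-conv   : ∀ {w v} → RH w v ⇔ RG v w
    T4 : ∀ {w u v} → RG w u → RG w v → RG u v ⊎ u ≡ v ⊎ RG v u
    T5 : ∀ {w u v} → RH w u → RH w v → RH u v ⊎ u ≡ v ⊎ RH v u
    T6 : ∀ {w u v} → RG w u → R□ u v → ∃[ x ] RAg w x × RG x v
    T7 : ∀ {w u} → R□ w u → Not (RG w u)

    D8  : ∀ {i w v} → R⊗[ i ] w v → R□ w v
    D9  : ∀ i w → ∃[ v ] R□ w v × (∀ u → R[ i ] v u → R⊗[ i ] w u)
    D10 : ∀ {i w v u z} → R□ w v → R□ w u → R⊗[ i ] u z → R⊗[ i ] v z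
    D11 : ∀ {i w v} → R⊗[ i ] w v →
          ∃[ u ] R□ w u × R[ i ] u v × (∀ z → R[ i ] u z → R⊗[ i ] w z)

  R : Modality n → Rel W 0ℓ
  R box       = R□
  R (agent i) = R[ i ]
  R grand     = RAg
  R always    = RG
  R hasAlways = RH
  R (ought i) = R⊗[ i ]

record Model (n : ℕ) : Set (lsuc 0ℓ) where
  field
    frame : Frame n
  open Frame frame public
  field
    V : Var → Pred W 0ℓ

infix 10 _,_⊨_

_,_⊨_ : (M : Model n) → Model.W M → Form n → Set
M , w ⊨ var p     = Model.V M p w
M , w ⊨ ¬ φ       = Not (M , w ⊨ φ)
M , w ⊨ φ ∧ ψ     = (M , w ⊨ φ) × (M , w ⊨ ψ)
M , w ⊨ modal m φ = ∀ u → Model.R M m w u → M , u ⊨ φ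

Satisfiable : Form n → Set (lsuc 0ℓ)
Satisfiable {n} φ = Σ[ M ∈ Model n ] ∃[ w ] (M , w ⊨ φ)

{-# OPTIONS --safe #-}
module Submission where

-- A Gabbay-style canonical model. Worlds are maximal consistent theories in which
-- every moment has a name p (p false in the moment, true before and after it), which
-- makes the moments irreflexive; the rule irr provides such theories, and saturation
-- transports them along □, G and H. Only these three relations are canonical. Those
-- for [i], [Ag] and ⊗ᵢ are filtered through the subformulas of φ, so that C2 and D9
-- become finite instances of ioa and ⊗⇒◇[]. For T6, let w < u with u and v in one
-- moment: F◇⇒AgF at w shows that v has a predecessor carrying the name of w's moment,
-- and that this predecessor satisfies every α with [Ag]α at w.

open import Defs
open import Axiom.ExcludedMiddle using (ExcludedMiddle)
open import Axiom.UniquenessOfIdentityProofs using (module Decidable⇒UIP)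
open import Data.Bool using (Bool; true; false; not; if_then_else_) renaming (_∧_ to _and_)
open import Data.Bool.Properties using (¬-not; not-¬)
open import Data.Empty using (⊥-elim)
open import Data.Fin using (Fin; zero; toℕ)
import Data.Fin.Properties as Fin
open import Data.List using (List; []; _∷_; _++_; map; concatMap; filter; tabulate; deduplicate; allFin)
open import Data.List.Membership.Propositional using (_∈_; find; lose)
open import Data.List.Membership.Propositional.Properties
  using (∈-map⁺; ∈-map⁻; ∈-++⁺ˡ; ∈-++⁺ʳ; ∈-++⁻; ∈-concatMap⁺; ∈-concatMap⁻;
         ∈-allFin; ∈-tabulate⁺; ∈-tabulate⁻; ∈-filter⁺; ∈-filter⁻; ∈-deduplicate⁺; ∈-deduplicate⁻)
open import Data.List.Properties using (filter-none)
open import Data.List.Relation.Unary.All using ([]; _∷_)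
import Data.List.Relation.Unary.All as All
import Data.List.Relation.Unary.All.Properties as All
open import Data.List.Relation.Unary.Any using (here; there)
open import Data.Nat using (ℕ; zero; suc; _+_; _*_; _≤_; _<_; _⊔_; NonZero)
open import Data.Nat.Induction using (<-rec)
open import Data.Nat.Properties
  using (suc-injective; *-cancelˡ-≡; even≢odd; +-comm; ≤-antisym; ≮⇒≥; m≤m⊔n; m≤n⊔m; ≤-trans; n≮n; ≤-refl)
open import Data.Product using (∃; ∃-syntax; _×_; _,_; proj₁; proj₂)
open import Data.Sum using (_⊎_; inj₁; inj₂)
import Data.Sum as Sum
open import Function using (mk⇔; _∘_)
open import Level using (0ℓ)
open import Relation.Binary using (Rel; IsEquivalence; Transitive; Symmetric)
open import Relation.Binary.PropositionalEquality using (_≡_; refl; sym; trans; cong; cong₂; subst)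
open import Relation.Nullary using (Dec; yes; no; does; contradiction) renaming (¬_ to Not)

private variable
  n : ℕ
  φ ψ χ : Form n
  v : Form n → Bool

-- Propositional reasoning inside a valuation

infix 10 _⊩_
infixl 9 _·_

-- A record, since `v` and `φ` cannot be inferred from the computed equation `eval v φ ≡ true`.
record _⊩_ (v : Form n → Bool) (φ : Form n) : Set where
  constructor holds
  field value : eval v φ ≡ true

open _⊩_

¬-intro : Not (v ⊩ φ) → v ⊩ ¬ φ
¬-intro {v = v} {φ} h with eval v φ in eq
... | true  = contradiction (holds eq) h
... | false = holds (cong not eq)

¬-elim : v ⊩ ¬ φ → Not (v ⊩ φ)
¬-elim (holds p) (holds q) = not-¬ refl (trans q (sym p))

∧-intro : v ⊩ φ → v ⊩ ψ → v ⊩ φ ∧ ψ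
∧-intro (holds p) (holds q) = holds (cong₂ _and_ p q)

∧-elimˡ : v ⊩ φ ∧ ψ → v ⊩ φ
∧-elimˡ {v = v} {φ} (holds p) with eval v φ in eq
... | true = holds eq

∧-elimʳ : v ⊩ φ ∧ ψ → v ⊩ ψ
∧-elimʳ {v = v} {φ} (holds p) with eval v φ
... | true = holds p

decide : ∀ v (φ : Form n) → v ⊩ φ ⊎ v ⊩ ¬ φ
decide v φ with eval v φ in eq
... | true  = inj₁ (holds eq)
... | false = inj₂ (holds (cong not eq))

stable : Not (v ⊩ ¬ φ) → v ⊩ φ
stable {v = v} {φ} h with decide v φ
... | inj₁ p = p
... | inj₂ q = contradiction q h

⇒-intro : (v ⊩ φ → v ⊩ ψ) → v ⊩ φ ⇒ ψ
⇒-intro f = ¬-intro λ h → ¬-elim (∧-elimʳ h) (f (∧-elimˡ h))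

_·_ : v ⊩ φ ⇒ ψ → v ⊩ φ → v ⊩ ψ
f · p = stable λ q → ¬-elim f (∧-intro p q)

∨-elim : v ⊩ φ ∨ ψ → v ⊩ φ ⊎ v ⊩ ψ
∨-elim {v = v} {φ} h with decide v φ
... | inj₁ p = inj₁ p
... | inj₂ p = inj₂ (stable λ q → ¬-elim h (∧-intro p q))

⊤-true : v ⊩ ⊤
⊤-true = ¬-intro λ h → ¬-elim (∧-elimʳ h) (∧-elimˡ h)

-- Propositional theorems are obtained semantically: reasoning under an arbitrary valuation yields a
-- tautology, which `taut` accepts.
valid : (∀ {v} → v ⊩ φ) → ⊢ φ
valid f = taut λ v → value (f {v})

infer : (∀ {v} → v ⊩ φ → v ⊩ ψ) → ⊢ φ → ⊢ ψ
infer f = mp (valid (⇒-intro f))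

infer₂ : (∀ {v} → v ⊩ φ → v ⊩ ψ → v ⊩ χ) → ⊢ φ → ⊢ ψ → ⊢ χ
infer₂ f d = mp (infer (λ p → ⇒-intro (f p)) d)

⇒-trans : ⊢ φ ⇒ ψ → ⊢ ψ ⇒ χ → ⊢ φ ⇒ χ
⇒-trans = infer₂ λ f g → ⇒-intro λ p → g · (f · p)

contrapose : ⊢ φ ⇒ ψ → ⊢ ¬ ψ ⇒ ¬ φ
contrapose = infer λ f → ⇒-intro λ q → ¬-intro λ p → ¬-elim q (f · p)

¬¬-intro : ⊢ φ ⇒ ¬ ¬ φ
¬¬-intro = valid (⇒-intro λ p → ¬-intro λ q → ¬-elim q p)

¬¬-elim : ⊢ ¬ ¬ φ ⇒ φ
¬¬-elim = valid (⇒-intro λ p → stable (¬-elim p))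

-- Finite conjunctions

conj-closed : (Q : Form n → Set) → Q ⊤ → (∀ {φ ψ} → Q φ → Q ψ → Q (φ ∧ ψ)) →
              ∀ φs → (∀ {φ} → φ ∈ φs → Q φ) → Q (conj φs)
conj-closed Q q⊤ q∧ []           h = q⊤
conj-closed Q q⊤ q∧ (φ ∷ [])     h = h (here refl)
conj-closed Q q⊤ q∧ (φ ∷ ψ ∷ φs) h =
  q∧ (h (here refl)) (conj-closed Q q⊤ q∧ (ψ ∷ φs) (h ∘ there))

conj-elim : ∀ φs → φ ∈ φs → v ⊩ conj φs → v ⊩ φ
conj-elim (φ ∷ [])     (here refl) h = h
conj-elim (φ ∷ ψ ∷ φs) (here refl) h = ∧-elimˡ h
conj-elim (φ ∷ ψ ∷ φs) (there i)   h = conj-elim (ψ ∷ φs) i (∧-elimʳ h)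

⋀-elim : (φ : Fin n → Form n) → ∀ i → v ⊩ ⋀ φ → v ⊩ φ i
⋀-elim φ i = conj-elim _ (∈-deduplicate⁺ _≟_ (∈-tabulate⁺ i))

⋀-closed : (Q : Form n → Set) → Q ⊤ → (∀ {φ ψ} → Q φ → Q ψ → Q (φ ∧ ψ)) →
           (φ : Fin n → Form n) → (∀ i → Q (φ i)) → Q (⋀ φ)
⋀-closed Q q⊤ q∧ φ h = conj-closed Q q⊤ q∧ _ λ m → subst Q (sym (eq m)) (h (index m))
  where
  index : ψ ∈ deduplicate _≟_ (tabulate φ) → Fin _
  index m = proj₁ (∈-tabulate⁻ (∈-deduplicate⁻ _≟_ (tabulate φ) m))
  eq : (m : ψ ∈ deduplicate _≟_ (tabulate φ)) → ψ ≡ φ (index m)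
  eq m = proj₂ (∈-tabulate⁻ (∈-deduplicate⁻ _≟_ (tabulate φ) m))

⋀-intro : (φ : Fin n → Form n) → (∀ i → v ⊩ φ i) → v ⊩ ⋀ φ
⋀-intro {v = v} = ⋀-closed (v ⊩_) ⊤-true ∧-intro

⊢⇒⋀ : (φ : Fin n → Form n) → (∀ i → ⊢ χ ⇒ φ i) → ⊢ χ ⇒ ⋀ φ
⊢⇒⋀ {χ = χ} = ⋀-closed (λ φ → ⊢ χ ⇒ φ) (valid (⇒-intro λ _ → ⊤-true))
  (infer₂ λ f g → ⇒-intro λ p → ∧-intro (f · p) (g · p))

-- All copies of `φ` after the first are filtered out. The argument `Fin n` excludes the empty
-- family, whose conjunction is `⊤`.
⋀-const : Fin n → (φ : Form n) → ⋀ {n} (λ _ → φ) ≡ φ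
⋀-const {suc n} _ φ = cong (λ φs → conj (φ ∷ φs)) (filter-none _
  (All.map (λ eq neq → neq eq) (All.deduplicate⁺ _≟_ (All.tabulate⁺ {n = n} {f = λ _ → φ} λ _ → refl))))

-- Countability of the language

-- `pair k l` is the number 2^k * (2l + 1), so its injectivity is a matter of parity.
pair : ℕ → ℕ → ℕ
pair zero    l = suc (2 * l)
pair (suc k) l = 2 * pair k l

pair-injective : ∀ k l k′ l′ → pair k l ≡ pair k′ l′ → k ≡ k′ × l ≡ l′
pair-injective zero    l zero     l′ eq = refl , *-cancelˡ-≡ l l′ 2 (suc-injective eq)
pair-injective zero    l (suc k′) l′ eq = contradiction (sym eq) (even≢odd (pair k′ l′) l)
pair-injective (suc k) l zero     l′ eq = contradiction eq (even≢odd (pair k l) l′)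
pair-injective (suc k) l (suc k′) l′ eq =
  let p , q = pair-injective k l k′ l′ (*-cancelˡ-≡ (pair k l) (pair k′ l′) 2 eq) in cong suc p , q

data Tree : Set where
  leaf : Tree
  node : Tree → Tree → Tree

node-injective : ∀ {s t s′ t′} → node s t ≡ node s′ t′ → s ≡ s′ × t ≡ t′
node-injective refl = refl , refl

codeᵗ : Tree → ℕ
codeᵗ leaf       = 0
codeᵗ (node s t) = suc (pair (codeᵗ s) (codeᵗ t))

codeᵗ-injective : ∀ s t → codeᵗ s ≡ codeᵗ t → s ≡ t
codeᵗ-injective leaf       leaf         eq = refl
codeᵗ-injective (node s t) (node s′ t′) eq =
  let p , q = pair-injective _ _ _ _ (suc-injective eq)
  in cong₂ node (codeᵗ-injective s s′ p) (codeᵗ-injective t t′ q)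

numeral : ℕ → Tree
numeral zero    = leaf
numeral (suc k) = node leaf (numeral k)

numeral-injective : ∀ k l → numeral k ≡ numeral l → k ≡ l
numeral-injective zero    zero    eq = refl
numeral-injective (suc k) (suc l) eq = cong suc (numeral-injective k l (proj₂ (node-injective eq)))

-- A nonzero numeral has `leaf` as its left child, so the left children `numeral 1` and `numeral 2`
-- separate the agent-indexed modalities from the other four and from each other.
treeᵐ : Modality n → Tree
treeᵐ box       = numeral 0
treeᵐ grand     = numeral 1
treeᵐ always    = numeral 2
treeᵐ hasAlways = numeral 3
treeᵐ (agent i) = node (numeral 1) (numeral (toℕ i))
treeᵐ (ought i) = node (numeral 2) (numeral (toℕ i))

treeᵐ-injective : (m m′ : Modality n) → treeᵐ m ≡ treeᵐ m′ → m ≡ m′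
treeᵐ-injective box       box       eq = refl
treeᵐ-injective grand     grand     eq = refl
treeᵐ-injective always    always    eq = refl
treeᵐ-injective hasAlways hasAlways eq = refl
treeᵐ-injective (agent i) (agent j) eq =
  cong agent (Fin.toℕ-injective (numeral-injective _ _ (proj₂ (node-injective eq))))
treeᵐ-injective (ought i) (ought j) eq =
  cong ought (Fin.toℕ-injective (numeral-injective _ _ (proj₂ (node-injective eq))))

treeᶠ : Form n → Tree
treeᶠ (var p)     = node (numeral 0) (numeral p)
treeᶠ (¬ φ)       = node (numeral 1) (treeᶠ φ)
treeᶠ (φ ∧ ψ)     = node (numeral 2) (node (treeᶠ φ) (treeᶠ ψ))
treeᶠ (modal m φ) = node (numeral 3) (node (treeᵐ m) (treeᶠ φ))

treeᶠ-injective : (φ ψ : Form n) → treeᶠ φ ≡ treeᶠ ψ → φ ≡ ψ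
treeᶠ-injective (var p)   (var q)     eq = cong var (numeral-injective p q (proj₂ (node-injective eq)))
treeᶠ-injective (¬ φ)     (¬ ψ)       eq = cong ¬_ (treeᶠ-injective φ ψ (proj₂ (node-injective eq)))
treeᶠ-injective (φ ∧ ψ)   (φ′ ∧ ψ′)   eq =
  let p , q = node-injective (proj₂ (node-injective eq))
  in cong₂ _∧_ (treeᶠ-injective φ φ′ p) (treeᶠ-injective ψ ψ′ q)
treeᶠ-injective (modal m φ) (modal m′ ψ) eq =
  let p , q = node-injective (proj₂ (node-injective eq))
  in cong₂ modal (treeᵐ-injective m m′ p) (treeᶠ-injective φ ψ q)

codeᶠ : Form n → ℕ
codeᶠ = codeᵗ ∘ treeᶠ

codeᶠ-injective : (φ ψ : Form n) → codeᶠ φ ≡ codeᶠ ψ → φ ≡ ψ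
codeᶠ-injective φ ψ eq = treeᶠ-injective φ ψ (codeᵗ-injective (treeᶠ φ) (treeᶠ ψ) eq)

-- Fresh variables and subformulas

bound : Form n → ℕ
bound (var p)     = suc p
bound (¬ φ)       = bound φ
bound (φ ∧ ψ)     = bound φ ⊔ bound ψ
bound (modal m φ) = bound φ

occurs⇒<bound : ∀ {p} (φ : Form n) → Occurs p φ → p < bound φ
occurs⇒<bound (var p)     refl     = ≤-refl
occurs⇒<bound (¬ φ)       o        = occurs⇒<bound φ o
occurs⇒<bound (φ ∧ ψ)     (inj₁ o) = ≤-trans (occurs⇒<bound φ o) (m≤m⊔n _ _)
occurs⇒<bound (φ ∧ ψ)     (inj₂ o) = ≤-trans (occurs⇒<bound ψ o) (m≤n⊔m (bound φ) _)
occurs⇒<bound (modal m φ) o        = occurs⇒<bound φ o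

bound-fresh : (φ : Form n) → Not (Occurs (bound φ) φ)
bound-fresh φ o = n≮n _ (occurs⇒<bound φ o)

subformulas : Form n → List (Form n)
subformulas (var p)     = var p ∷ []
subformulas (¬ φ)       = ¬ φ ∷ subformulas φ
subformulas (φ ∧ ψ)     = φ ∧ ψ ∷ subformulas φ ++ subformulas ψ
subformulas (modal m φ) = modal m φ ∷ subformulas φ

self∈subformulas : (φ : Form n) → φ ∈ subformulas φ
self∈subformulas (var p)     = here refl
self∈subformulas (¬ φ)       = here refl
self∈subformulas (φ ∧ ψ)     = here refl
self∈subformulas (modal m φ) = here refl

-- Derived modal principles

module Completeness (em : ExcludedMiddle 0ℓ) {n : ℕ} (i₀ : Fin n) where

  private variable
    α β γ δ : Form n

  K : ∀ m → ⊢ modal m (α ⇒ β) ⇒ modal m α ⇒ modal m β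
  K box       = K-□
  K (agent i) = K-[]
  K grand     = K-Ag
  K always    = K-G
  K hasAlways = K-H
  K (ought i) = K-⊗

  -- This is indep at the constant family α, for which ⋀ collapses to α.
  nec-Ag : ⊢ α → ⊢ [Ag] α
  nec-Ag {α} d = subst (λ β → ⊢ [Ag] β) (⋀-const i₀ α)
    (mp indep (mp (⊢⇒⋀ {χ = ⊤} (λ i → [ i ] α) λ i →
      infer (λ p → ⇒-intro λ _ → ∧-elimˡ p) (mp □⇒[]∧⊗ (nec-□ d))) (valid ⊤-true)))

  nec : ∀ m → ⊢ α → ⊢ modal m α
  nec box       d = nec-□ d
  nec (agent i) d = infer ∧-elimˡ (mp □⇒[]∧⊗ (nec-□ d))
  nec grand     d = nec-Ag d
  nec always    d = nec-G d
  nec hasAlways d = nec-H d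
  nec (ought i) d = infer ∧-elimʳ (mp (□⇒[]∧⊗ {i = i}) (nec-□ d))

  modal-mono : ∀ m → ⊢ α ⇒ β → ⊢ modal m α ⇒ modal m β
  modal-mono m d = mp (K m) (nec m d)

  ◇-mono : ∀ m → ⊢ α ⇒ β → ⊢ ¬ modal m (¬ α) ⇒ ¬ modal m (¬ β)
  ◇-mono m d = contrapose (modal-mono m (contrapose d))

  record IsS5 (m : Modality n) : Set where
    field
      T : ⊢ modal m α ⇒ α
      5′ : ⊢ ¬ modal m (¬ α) ⇒ modal m (¬ modal m (¬ α))

  open IsS5

  □-S5 : IsS5 box
  □-S5 = record { T = T-□ ; 5′ = 5-□ }

  []-S5 : ∀ i → IsS5 (agent i)
  []-S5 i = record { T = T-[] ; 5′ = 5-[] }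

  Ag-S5 : IsS5 grand
  Ag-S5 = record { T = T-Ag ; 5′ = 5-Ag }

  S5-5 : {m : Modality n} → IsS5 m → ⊢ ¬ modal m α ⇒ modal m (¬ modal m α)
  S5-5 {m = m} s = ⇒-trans (contrapose (modal-mono m ¬¬-elim))
    (⇒-trans (5′ s) (modal-mono m (contrapose (modal-mono m ¬¬-intro))))

  -- From `modal m α`, `T` yields its possibility, `S5-5` boxes this, and under the box the
  -- contrapositive of `S5-5` returns `modal m α`.
  S5-4 : {m : Modality n} → IsS5 m → ⊢ modal m α ⇒ modal m (modal m α)
  S5-4 {m = m} s = ⇒-trans ¬¬-intro (⇒-trans (contrapose (T s))
    (⇒-trans (S5-5 s) (modal-mono m (⇒-trans (contrapose (S5-5 s)) ¬¬-elim))))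

  -- `indep` for the family that is `α` at `i` and `⊤` elsewhere; each `[ j ] ⊤` is a theorem.
  []⇒Ag : ∀ i → ⊢ [ i ] α ⇒ [Ag] α
  []⇒Ag {α = α} i = ⇒-trans (⊢⇒⋀ (λ j → [ j ] family j) premise)
    (⇒-trans indep (modal-mono grand (valid (⇒-intro conclusion))))
    where
    family : Fin _ → Form _
    family j with j Fin.≟ i
    ... | yes _ = α
    ... | no  _ = ⊤
    premise : ∀ j → ⊢ [ i ] α ⇒ [ j ] family j
    premise j with j Fin.≟ i
    ... | yes refl = valid (⇒-intro λ p → p)
    ... | no  _    = infer (λ p → ⇒-intro λ _ → p) (nec (agent j) (valid ⊤-true))
    family-i : family i ≡ α
    family-i with i Fin.≟ i
    ... | yes _ = refl
    ... | no  i≢i = contradiction refl i≢i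
    conclusion : v ⊩ ⋀ family → v ⊩ α
    conclusion {v = v} p = subst (v ⊩_) family-i (⋀-elim family i p)

  □⇒[] : ∀ {i} → ⊢ □ α ⇒ [ i ] α
  □⇒[] = ⇒-trans □⇒[]∧⊗ (valid (⇒-intro ∧-elimˡ))

  □⇒Ag : ⊢ □ α ⇒ [Ag] α
  □⇒Ag = ⇒-trans □⇒[] ([]⇒Ag i₀)

  -- Contexts and names

  data Kind : Set where
    now future past : Kind

  ⌊_⌋ : Kind → Modality n
  ⌊ now ⌋    = box
  ⌊ future ⌋ = always
  ⌊ past ⌋   = hasAlways

  _⁻ : Kind → Kind
  now ⁻    = now
  future ⁻ = past
  past ⁻   = future

  dia : Kind → Form n → Form n
  dia k α = ¬ modal ⌊ k ⌋ (¬ α)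

  conv : ∀ k → ⊢ α ⇒ modal ⌊ k ⌋ (dia (k ⁻) α)
  conv now    = ⇒-trans (⇒-trans ¬¬-intro (contrapose T-□)) 5-□
  conv future = conv-GP
  conv past   = conv-HF

  conv⁻ : ∀ k → ⊢ α ⇒ modal ⌊ k ⁻ ⌋ (dia k α)
  conv⁻ now    = conv now
  conv⁻ future = conv past
  conv⁻ past   = conv future

  -- Moves a diamond across a refuted conjunction when `m` acts as a converse of `l`: by the first
  -- premise, `β` makes every `l`-successor satisfy the `m`-diamond of `β`, so none can satisfy `α`.
  adjoint : ∀ l m → ⊢ β ⇒ modal l (¬ modal m (¬ β)) →
            ⊢ ¬ (α ∧ ¬ modal m (¬ β)) → ⊢ ¬ (¬ modal l (¬ α) ∧ β)
  adjoint l m c d = infer₂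
    (λ f g → ¬-intro λ p → ¬-elim (∧-elimˡ p) (g · (f · ∧-elimʳ p)))
    c
    (modal-mono l (infer (λ p → ⇒-intro λ q → ¬-intro λ r → ¬-elim p (∧-intro r q)) d))

  -- Contexts use only □, G and H: these have converses, so that irr-plug can turn a
  -- context inside out until irr applies at its hole; ⊗ᵢ has no converse.
  data Ctx : Set where
    hole   : Ctx
    guard  : Form n → Ctx → Ctx
    within : Kind → Ctx → Ctx

  plug : Ctx → Form n → Form n
  plug hole         α = α
  plug (guard β C)  α = β ∧ plug C α
  plug (within k C) α = dia k (plug C α)

  -- Holds throughout the moment (□-class) named by p, where p is false there
  -- and true at all its proper past and future points.
  name : Var → Form n
  name p = □ ¬ var p ∧ □ (G var p ∧ H var p)

  -- Induction on the context, moving its outermost layer into the left conjunct: a guard joins `α`,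
  -- a diamond becomes its converse on `α`.
  irr-plug : ∀ {q} C → Not (Occurs q (α ∧ plug C ⊤)) →
             ⊢ ¬ (α ∧ plug C (name q)) → ⊢ ¬ (α ∧ plug C ⊤)
  irr-plug {α = α} hole q∉ d = infer (λ p → ¬-intro λ r → ¬-elim p (∧-elimˡ r))
    (irr {φ = ¬ α} (λ o → q∉ (inj₁ o)) (infer (λ p → ⇒-intro λ r → ¬-intro λ s → ¬-elim p (∧-intro s r)) d))
  irr-plug (guard β C) q∉ d = reassociateʳ (irr-plug C (q∉ ∘ Sum.assocʳ) (reassociateˡ d))
    where
    reassociateˡ : ⊢ ¬ (α ∧ (β ∧ γ)) → ⊢ ¬ ((α ∧ β) ∧ γ)
    reassociateˡ = infer λ p → ¬-intro λ r →
      ¬-elim p (∧-intro (∧-elimˡ (∧-elimˡ r)) (∧-intro (∧-elimʳ (∧-elimˡ r)) (∧-elimʳ r)))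
    reassociateʳ : ⊢ ¬ ((α ∧ β) ∧ γ) → ⊢ ¬ (α ∧ (β ∧ γ))
    reassociateʳ = infer λ p → ¬-intro λ r →
      ¬-elim p (∧-intro (∧-intro (∧-elimˡ r) (∧-elimˡ (∧-elimʳ r))) (∧-elimʳ (∧-elimʳ r)))
  -- `Occurs` ignores `¬` and modalities, so the freshness hypothesis is unchanged when the diamond
  -- moves.
  irr-plug (within k C) q∉ d = unshift (irr-plug C q∉ (shift d))
    where
    swap : ⊢ ¬ (α ∧ β) → ⊢ ¬ (β ∧ α)
    swap = infer λ p → ¬-intro λ r → ¬-elim p (∧-intro (∧-elimʳ r) (∧-elimˡ r))
    shift : ⊢ ¬ (α ∧ dia k β) → ⊢ ¬ (dia (k ⁻) α ∧ β)
    shift = adjoint ⌊ k ⁻ ⌋ ⌊ k ⌋ (conv⁻ k)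
    unshift : ⊢ ¬ (dia (k ⁻) α ∧ β) → ⊢ ¬ (α ∧ dia k β)
    unshift = swap ∘ adjoint ⌊ k ⌋ ⌊ k ⁻ ⌋ (conv k) ∘ swap

  -- A valuation respects the Boolean connectives, so one that verifies all theorems is a maximal
  -- consistent theory.
  record World : Set where
    field
      val       : Form n → Bool
      theorems  : ⊢ α → val ⊩ α
      saturated : ∀ C → val ⊩ plug C ⊤ → ∃[ q ] val ⊩ plug C (name q)

  open World

  skeleton : Ctx → Form n
  skeleton hole         = var 0
  skeleton (guard α C)  = α ∧ skeleton C
  skeleton (within k C) = modal ⌊ k ⌋ (skeleton C)

  ⌊⌋-injective : ∀ k l → ⌊ k ⌋ ≡ ⌊ l ⌋ → k ≡ l
  ⌊⌋-injective now    now    eq = refl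
  ⌊⌋-injective future future eq = refl
  ⌊⌋-injective past   past   eq = refl

  ∧-injective : α ∧ β ≡ γ ∧ δ → α ≡ γ × β ≡ δ
  ∧-injective refl = refl , refl

  modal-injective : ∀ {m m′} → modal m α ≡ modal m′ β → m ≡ m′ × α ≡ β
  modal-injective refl = refl , refl

  skeleton-injective : ∀ C D → skeleton C ≡ skeleton D → C ≡ D
  skeleton-injective hole         hole         eq = refl
  skeleton-injective (guard α C)  (guard β D)  eq =
    let p , q = ∧-injective eq in cong₂ guard p (skeleton-injective C D q)
  skeleton-injective (within k C) (within l D) eq =
    let p , q = modal-injective eq in cong₂ within (⌊⌋-injective k l p) (skeleton-injective C D q)

  codeᶜ : Ctx → ℕ
  codeᶜ = codeᶠ ∘ skeleton

  codeᶜ-injective : ∀ C D → codeᶜ C ≡ codeᶜ D → C ≡ D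
  codeᶜ-injective C D eq = skeleton-injective C D (codeᶠ-injective _ _ eq)

  -- Saturated worlds

  -- What the Lindenbaum construction asks of a notion of consistency. It is run for irrefutability,
  -- giving the root, and for possibility along `k` at `w`, giving successors.
  record Consistency (Con : Form n → Set) : Set where
    field
      up         : ⊢ α ⇒ β → Con α → Con β
      noncontra  : Not (Con ⊥)
      split      : Con α → Not (Con (α ∧ β)) → Con (α ∧ ¬ β)
      witness    : ∀ C → Con (α ∧ plug C ⊤) → ∃[ q ] Con (α ∧ plug C (name q))

  module Lindenbaum {Con : Form n → Set} (consistency : Consistency Con) (α₀ : Form n) (con₀ : Con α₀) where
    open Consistency consistency

    -- Each extension settles one context: either its hole receives a name or the negation of
    -- `plug C ⊤` is added. Plain formulas are settled through the contexts `guard α hole`.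
    extend : Ctx → ∃ Con → ∃ Con
    extend C (α , c) with em {Con (α ∧ plug C ⊤)}
    ... | yes c′ = let q , c″ = witness C c′ in α ∧ plug C (name q) , c″
    ... | no ¬c′ = α ∧ ¬ plug C ⊤ , split c ¬c′

    stage : ℕ → ∃ Con
    stage zero = α₀ , con₀
    stage (suc k) with em {∃[ C ] codeᶜ C ≡ k}
    ... | yes (C , _) = extend C (stage k)
    ... | no  _       = stage k

    stageᶠ : ℕ → Form n
    stageᶠ k = proj₁ (stage k)

    extend-⇒ : ∀ C s → ⊢ proj₁ (extend C s) ⇒ proj₁ s
    extend-⇒ C (α , c) with em {Con (α ∧ plug C ⊤)}
    ... | yes _ = valid (⇒-intro ∧-elimˡ)
    ... | no  _ = valid (⇒-intro ∧-elimˡ)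

    stage-⇒ : ∀ j k → ⊢ stageᶠ (j + k) ⇒ stageᶠ k
    stage-⇒ zero    k = valid (⇒-intro λ p → p)
    stage-⇒ (suc j) k = ⇒-trans one-step (stage-⇒ j k)
      where
      one-step : ⊢ stageᶠ (suc (j + k)) ⇒ stageᶠ (j + k)
      one-step with em {∃[ C ] codeᶜ C ≡ j + k}
      ... | yes (C , _) = extend-⇒ C (stage (j + k))
      ... | no  _       = valid (⇒-intro λ p → p)

    Limit : Form n → Set
    Limit α = ∃[ k ] ⊢ stageᶠ k ⇒ α

    limit-up : ⊢ α ⇒ β → Limit α → Limit β
    limit-up d (k , e) = k , ⇒-trans e d

    limit-theorem : ⊢ α → Limit α
    limit-theorem d = 0 , infer (λ p → ⇒-intro λ _ → p) d

    limit-∧ : Limit α → Limit β → Limit (α ∧ β)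
    limit-∧ (k , d) (l , e) = k + l , infer₂ (λ f g → ⇒-intro λ p → ∧-intro (f · p) (g · p))
      (⇒-trans (subst (λ j → ⊢ stageᶠ j ⇒ stageᶠ k) (+-comm l k) (stage-⇒ l k)) d)
      (⇒-trans (stage-⇒ k l) e)

    limit-con : Limit α → Con α
    limit-con (k , d) = up d (proj₂ (stage k))

    limit-noncontra : Limit α → Not (Limit (¬ α))
    limit-noncontra p q = noncontra (limit-con (limit-up
      (valid (⇒-intro λ h → ⊥-elim (¬-elim (∧-elimʳ h) (∧-elimˡ h)))) (limit-∧ p q)))

    extend-decides : ∀ C s →
      (∃[ q ] ⊢ proj₁ (extend C s) ⇒ plug C (name q)) ⊎ (⊢ proj₁ (extend C s) ⇒ ¬ plug C ⊤)
    extend-decides C (α , c) with em {Con (α ∧ plug C ⊤)}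
    ... | yes c′ = inj₁ (proj₁ (witness C c′) , valid (⇒-intro ∧-elimʳ))
    ... | no  _  = inj₂ (valid (⇒-intro ∧-elimʳ))

    limit-decides : ∀ C → (∃[ q ] Limit (plug C (name q))) ⊎ Limit (¬ plug C ⊤)
    limit-decides C with stage-decides
      where
      stage-decides : (∃[ q ] ⊢ stageᶠ (suc (codeᶜ C)) ⇒ plug C (name q)) ⊎
                      (⊢ stageᶠ (suc (codeᶜ C)) ⇒ ¬ plug C ⊤)
      stage-decides with em {∃[ D ] codeᶜ D ≡ codeᶜ C}
      ... | no  none     = contradiction (C , refl) none
      -- The stage treats some context with this code, which injectivity identifies with `C`.
      ... | yes (D , eq) with codeᶜ-injective D C eq
      ... | refl = extend-decides C (stage (codeᶜ C))
    ... | inj₁ (q , d) = inj₁ (q , suc (codeᶜ C) , d)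
    ... | inj₂ d       = inj₂ (suc (codeᶜ C) , d)

    limit-complete : Not (Limit α) → Limit (¬ α)
    limit-complete {α} h with limit-decides (guard α hole)
    ... | inj₁ (q , d) = contradiction (limit-up (valid (⇒-intro ∧-elimˡ)) d) h
    ... | inj₂ d       = limit-up (contrapose (valid (⇒-intro λ p → ∧-intro p ⊤-true))) d

    valuation : Form n → Bool
    valuation α = does (em {Limit α})

    atom-sound : valuation α ≡ true → Limit α
    atom-sound {α} eq with em {Limit α}
    ... | yes l = l

    atom-complete : Limit α → valuation α ≡ true
    atom-complete {α} l with em {Limit α}
    ... | yes _ = refl
    ... | no ¬l = contradiction l ¬l

    ⊩⇒limit : ∀ α → valuation ⊩ α → Limit α
    limit⇒⊩ : ∀ α → Limit α → valuation ⊩ α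
    ⊩⇒limit (var p)     (holds h) = atom-sound h
    ⊩⇒limit (¬ α)       h = limit-complete λ l → ¬-elim h (limit⇒⊩ α l)
    ⊩⇒limit (α ∧ β)     h = limit-∧ (⊩⇒limit α (∧-elimˡ h)) (⊩⇒limit β (∧-elimʳ h))
    ⊩⇒limit (modal m α) (holds h) = atom-sound h
    limit⇒⊩ (var p)     l = holds (atom-complete l)
    limit⇒⊩ (¬ α)       l = ¬-intro λ h → limit-noncontra (⊩⇒limit α h) l
    limit⇒⊩ (α ∧ β)     l = ∧-intro (limit⇒⊩ α (limit-up (valid (⇒-intro ∧-elimˡ)) l))
                                    (limit⇒⊩ β (limit-up (valid (⇒-intro ∧-elimʳ)) l))
    limit⇒⊩ (modal m α) l = holds (atom-complete l)

    world : World
    world = record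
      { val       = valuation
      ; theorems  = λ d → limit⇒⊩ _ (limit-theorem d)
      ; saturated = λ C h → saturate C h (limit-decides C)
      }
      where
      saturate : ∀ C → valuation ⊩ plug C ⊤ → (∃[ q ] Limit (plug C (name q))) ⊎ Limit (¬ plug C ⊤) →
                 ∃[ q ] valuation ⊩ plug C (name q)
      saturate C h (inj₁ (q , l)) = q , limit⇒⊩ _ l
      saturate C h (inj₂ l)       = contradiction h (¬-elim (limit⇒⊩ _ l))

    α₀∈world : val world ⊩ α₀
    α₀∈world = limit⇒⊩ α₀ (0 , valid (⇒-intro λ p → p))

    world-con : val world ⊩ α → Con α
    world-con h = limit-con (⊩⇒limit _ h)

  -- The two notions of consistency and canonical successors

  root-consistency : Consistency (λ α → Not (⊢ ¬ α))
  root-consistency = record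
    { up        = λ d c e → c (mp (contrapose d) e)
    ; noncontra = λ c → c (valid ⊤-true)
    ; split     = λ c h e → h λ f → c (infer₂
        (λ p q → ¬-intro λ r → ¬-elim p (∧-intro r (¬-intro λ s → ¬-elim q (∧-intro r s)))) e f)
    ; witness   = λ {α} C c → bound (α ∧ plug C ⊤) , λ d → c (irr-plug C (bound-fresh (α ∧ plug C ⊤)) d)
    }

  infer-at : ∀ w → ⊢ α ⇒ β → val w ⊩ α → val w ⊩ β
  infer-at w d p = theorems w d · p

  modal-infer₂ : ∀ w m → (∀ {v} → v ⊩ α → v ⊩ β → v ⊩ γ) →
                 val w ⊩ modal m α → val w ⊩ modal m β → val w ⊩ modal m γ
  modal-infer₂ w m f p q =
    infer-at w (⇒-trans (modal-mono m (valid (⇒-intro λ a → ⇒-intro (f a)))) (K m)) p · q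

  successor-consistency : ∀ w k → Consistency (λ α → val w ⊩ dia k α)
  successor-consistency w k = record
    { up        = λ d → infer-at w (◇-mono ⌊ k ⌋ d)
    ; noncontra = λ c → ¬-elim c (theorems w (nec ⌊ k ⌋ (valid ⊤-true)))
    ; split     = λ c h → ¬-intro λ p → ¬-elim c (modal-infer₂ w ⌊ k ⌋
        (λ p q → ¬-intro λ r → ¬-elim p (∧-intro r (¬-intro λ s → ¬-elim q (∧-intro r s)))) p
        (stable h))
    -- The diamond and `α` are absorbed into the context, so saturation of `w` itself supplies the
    -- name.
    ; witness   = λ {α} C → saturated w (within k (guard α C))
    }

  Related : Kind → World → World → Set
  Related k w u = ∀ α → val w ⊩ modal ⌊ k ⌋ α → val u ⊩ α

  successor : ∀ w k → val w ⊩ dia k α → ∃[ u ] Related k w u × val u ⊩ α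
  successor {α} w k h = world , related , α₀∈world
    where
    open Lindenbaum (successor-consistency w k) α h
    related : Related k w world
    related α p = stable λ q → ¬-elim (world-con q) (infer-at w (modal-mono ⌊ k ⌋ ¬¬-intro) p)

  related-converse : ∀ k {w u} → Related k w u → Related (k ⁻) u w
  related-converse k {w} {u} r α p = stable λ q →
    ¬-elim (r _ (infer-at w (conv k) q)) (infer-at u (modal-mono ⌊ k ⁻ ⌋ ¬¬-intro) p)

  -- Countable addresses of worlds and least representatives

  data Path : Set where
    root : Path
    step : Path → Kind → Form n → Path

  pathᶠ : Path → Form n
  pathᶠ root         = var 0
  pathᶠ (step p k α) = modal ⌊ k ⌋ (pathᶠ p ∧ α)

  pathᶠ-injective : ∀ p q → pathᶠ p ≡ pathᶠ q → p ≡ q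
  pathᶠ-injective root         root         eq = refl
  pathᶠ-injective (step p k α) (step q l β) eq with modal-injective eq
  ... | eq₁ , eq₂ with ∧-injective eq₂
  ... | eq₃ , refl with pathᶠ-injective p q eq₃ | ⌊⌋-injective k l eq₁
  ... | refl | refl = refl

  codeᵖ : Path → ℕ
  codeᵖ = codeᶠ ∘ pathᶠ

  codeᵖ-injective : ∀ p q → codeᵖ p ≡ codeᵖ q → p ≡ q
  codeᵖ-injective p q eq = pathᶠ-injective p q (codeᶠ-injective _ _ eq)

  least : (Q : ℕ → Set) → ∀ k → Q k → ∃[ m ] Q m × (∀ j → Q j → m ≤ j)
  least Q = <-rec _ λ k rec q → search k rec q (em {∃[ j ] j < k × Q j})
    where
    search : ∀ k → (∀ {j} → j < k → Q j → ∃[ m ] Q m × (∀ j → Q j → m ≤ j)) → Q k →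
             Dec (∃[ j ] j < k × Q j) → ∃[ m ] Q m × (∀ j → Q j → m ≤ j)
    search k rec q (yes (j , j<k , qj)) = rec j<k qj
    search k rec q (no none)            = k , q , λ j qj → ≮⇒≥ λ j<k → none (j , j<k , qj)

  module Representatives {A : Set} (code : A → ℕ) (code-injective : ∀ x y → code x ≡ code y → x ≡ y)
                         (_≈_ : Rel A 0ℓ) (≈-equiv : IsEquivalence _≈_) where
    private module ≈ = IsEquivalence ≈-equiv

    minimum : ∀ x → ∃[ m ] (∃[ y ] code y ≡ m × x ≈ y) × (∀ j → (∃[ y ] code y ≡ j × x ≈ y) → m ≤ j)
    minimum x = least _ (code x) (x , refl , ≈.refl)

    rep : A → A
    rep x = proj₁ (proj₁ (proj₂ (minimum x)))

    rep-≈ : ∀ x → x ≈ rep x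
    rep-≈ x = proj₂ (proj₂ (proj₁ (proj₂ (minimum x))))

    rep-least : ∀ {x y} → x ≈ y → code (rep x) ≤ code y
    rep-least {x} {y} e = subst (_≤ code y) (sym (proj₁ (proj₂ (proj₁ (proj₂ (minimum x))))))
      (proj₂ (proj₂ (minimum x)) (code y) (y , refl , e))

    rep-cong : ∀ {x y} → x ≈ y → rep x ≡ rep y
    rep-cong e = code-injective _ _ (≤-antisym
      (rep-least (≈.trans e (rep-≈ _))) (rep-least (≈.trans (≈.sym e) (rep-≈ _))))

    Quotient : Set
    Quotient = ∃[ x ] rep x ≡ x

    class : A → Quotient
    class x = rep x , sym (rep-cong (rep-≈ x))

    class-injective : (c d : Quotient) → proj₁ c ≈ proj₁ d → c ≡ d
    class-injective (x , p) (y , q) e = pack (trans (sym p) (trans (rep-cong e) q)) p q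
      where
      -- Excluded middle decides equality on `A`, so proofs of `rep x ≡ x` are unique.
      open Decidable⇒UIP {A = A} (λ x y → em)
      pack : ∀ {x y} → x ≡ y → (p : rep x ≡ x) (q : rep y ≡ y) → (x , p) ≡ (y , q)
      pack refl p q = cong (_ ,_) (≡-irrelevant p q)

  -- The canonical model

  module Canonical (Γ₀ : World) where

    -- A path records the diamonds followed from the root, so the worlds reached have countably many
    -- addresses. A step whose diamond fails stays where it is, which keeps `at` total.
    at : Path → World
    at root = Γ₀
    at (step p k α) with em {val (at p) ⊩ dia k α}
    ... | yes h = proj₁ (successor (at p) k h)
    ... | no  _ = at p

    at-successor : ∀ p k → val (at p) ⊩ dia k α → ∃[ q ] Related k (at p) (at q) × val (at q) ⊩ α
    at-successor {α} p k h = step p k α , found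
      where
      found : Related k (at p) (at (step p k α)) × val (at (step p k α)) ⊩ α
      found with em {val (at p) ⊩ dia k α}
      ... | yes h′ = proj₂ (successor (at p) k h′)
      ... | no ¬h  = contradiction h ¬h

    _≐_ : Rel Path 0ℓ
    p ≐ q = ∀ α → val (at p) ⊩ α → val (at q) ⊩ α

    -- Inclusion between maximal theories is already equality: a formula missing from the smaller
    -- one would enter the larger one negated.
    ≐-sym : Symmetric _≐_
    ≐-sym s α h = stable λ h′ → ¬-elim (s _ h′) h

    ≐-equiv : IsEquivalence _≐_
    ≐-equiv = record
      { refl = λ α h → h ; sym = λ {p} {q} → ≐-sym {p} {q} ; trans = λ s t α h → t α (s α h) }

    -- T4 and T5 ask for propositional equality of worlds, hence the quotient.
    open Representatives codeᵖ codeᵖ-injective _≐_ ≐-equiv public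
      using (rep-≈; class; class-injective) renaming (Quotient to W)

    ⟦_⟧ : W → World
    ⟦ p , _ ⟧ = at p

    infix 10 _∋_

    _∋_ : W → Form n → Set
    w ∋ α = val ⟦ w ⟧ ⊩ α

    Rᵏ : Kind → Rel W 0ℓ
    Rᵏ k w u = Related k ⟦ w ⟧ ⟦ u ⟧

    private variable
      w u : W

    ◇-elim : ∀ k → w ∋ dia k α → ∃[ u ] Rᵏ k w u × u ∋ α
    ◇-elim {p , _} {α} k h =
      let q , r , h′ = at-successor p k h in class q , (λ β h″ → rep-≈ q β (r β h″)) , rep-≈ q α h′

    ◇-intro : ∀ k → Rᵏ k w u → u ∋ α → w ∋ dia k α
    ◇-intro k r h = ¬-intro λ p → ¬-elim (r _ p) h

    □-intro : ∀ {w} k → (∀ u → Rᵏ k w u → u ∋ α) → w ∋ modal ⌊ k ⌋ α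
    □-intro {w = w} k h = stable λ p →
      let u , r , q = ◇-elim {w = w} k (infer-at ⟦ w ⟧ (contrapose (modal-mono ⌊ k ⌋ ¬¬-elim)) p)
      in ¬-elim q (h u r)

    R-converse : ∀ k {w u} → Rᵏ k w u → Rᵏ (k ⁻) u w
    R-converse k {w} {u} = related-converse k {⟦ w ⟧} {⟦ u ⟧}

    R-trans : ∀ k → (∀ {α} → ⊢ modal ⌊ k ⌋ α ⇒ modal ⌊ k ⌋ (modal ⌊ k ⌋ α)) → Transitive (Rᵏ k)
    R-trans k four {w} r s α h = s α (r _ (infer-at ⟦ w ⟧ four h))

    R□-equiv : IsEquivalence (Rᵏ now)
    R□-equiv = record
      { refl  = λ {w} α h → infer-at ⟦ w ⟧ T-□ h
      ; sym   = λ {w} {u} → R-converse now {w} {u}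
      ; trans = λ {w} {u} {u′} → R-trans now (S5-4 □-S5) {w} {u} {u′}
      }

    module □ = IsEquivalence R□-equiv

    -- Names, irreflexivity and linearity

    named : ∀ w → ∃[ p ] w ∋ name p
    named w = saturated ⟦ w ⟧ hole ⊤-true

    name-moment : ∀ {w u p} → w ∋ name p → Rᵏ now w u → u ∋ name p
    name-moment {w} h r =
      ∧-intro (r _ (infer-at ⟦ w ⟧ (S5-4 □-S5) (∧-elimˡ h))) (r _ (infer-at ⟦ w ⟧ (S5-4 □-S5) (∧-elimʳ h)))

    name-false : ∀ {w p} → w ∋ name p → Not (w ∋ var p)
    name-false {w} h = ¬-elim (infer-at ⟦ w ⟧ T-□ (∧-elimˡ h))

    name-future : ∀ {w u p} → w ∋ name p → Rᵏ future w u → u ∋ var p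
    name-future {w} h r = r _ (∧-elimˡ (infer-at ⟦ w ⟧ T-□ (∧-elimʳ h)))

    name-past : ∀ {w u p} → w ∋ name p → Rᵏ past w u → u ∋ var p
    name-past {w} h r = r _ (∧-elimʳ (infer-at ⟦ w ⟧ T-□ (∧-elimʳ h)))

    irreflexive : ∀ {w u} → Rᵏ now w u → Not (Rᵏ future w u)
    irreflexive {w} {u} r s =
      let p , h = named w in name-false {u} (name-moment {w} {u} h r) (name-future {w} {u} h s)

    separate : ∀ {w u} (f : Form n → Form n) → Not (∀ α → w ∋ f α → u ∋ α) → ∃[ α ] w ∋ f α × u ∋ ¬ α
    separate {w} {u} f h with em {∃[ α ] w ∋ f α × u ∋ ¬ α}
    ... | yes e = e
    ... | no ¬e = contradiction (λ α p → stable λ q → ¬e (α , p , q)) h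

    -- If all three alternatives failed, witnesses would give `G α`, `β` and `H γ` at `w` but
    -- `¬ α ∧ ¬ β ∧ ¬ γ` at `u`; each disjunct of the hypothesis for that conjunction contradicts
    -- one of them.
    comparable : ∀ {w u} → (∀ α → u ∋ α → w ∋ P α ∨ α ∨ F α) → Rᵏ future w u ⊎ w ≡ u ⊎ Rᵏ past w u
    comparable {w} {u} h with em {Rᵏ future w u} | em {∀ α → w ∋ α → u ∋ α} | em {Rᵏ past w u}
    ... | yes r | _     | _     = inj₁ r
    ... | no _  | yes e | _     = inj₂ (inj₁ (class-injective w u e))
    ... | no _  | no _  | yes r = inj₂ (inj₂ r)
    ... | no a  | no b  | no c  with separate {w} {u} G_ a | separate {w} {u} (λ α → α) b | separate {w} {u} H_ c
    ... | α , wα , uα | β , wβ , uβ | γ , wγ , uγ with ∨-elim (h (¬ α ∧ ¬ β ∧ ¬ γ) (∧-intro uα (∧-intro uβ uγ)))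
    ... | inj₁ p = let x , r , q = ◇-elim {w} past p in contradiction (r γ wγ) (¬-elim (∧-elimʳ (∧-elimʳ q)))
    ... | inj₂ p with ∨-elim p
    ... | inj₁ q = contradiction wβ (¬-elim (∧-elimˡ (∧-elimʳ q)))
    ... | inj₂ p = let x , r , q = ◇-elim {w} future p in contradiction (r α wα) (¬-elim (∧-elimˡ q))

    forward-linear : ∀ {w u u′} → Rᵏ future w u → Rᵏ future w u′ → Rᵏ future u u′ ⊎ u ≡ u′ ⊎ Rᵏ past u u′
    forward-linear {w} {u} {u′} r s = comparable {u} {u′} λ α h → infer-at ⟦ u ⟧ lin-PF
      (◇-intro {u} {w} past (R-converse future {w} {u} r) (◇-intro {w} {u′} future s h))

    backward-linear : ∀ {w u u′} → Rᵏ past w u → Rᵏ past w u′ → Rᵏ future u u′ ⊎ u ≡ u′ ⊎ Rᵏ past u u′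
    backward-linear {w} {u} {u′} r s = comparable {u} {u′} λ α h → infer-at ⟦ u ⟧ lin-FP
      (◇-intro {u} {w} future (R-converse past {w} {u} r) (◇-intro {w} {u′} past s h))

    -- The history through u′ meets the moment of w in exactly one world x, since
    -- that moment has a name; hence x satisfies every α with [Ag]α true at w.
    no-choice-between-undivided : ∀ {w u u′} → Rᵏ future w u → Rᵏ now u u′ →
      ∃[ x ] Rᵏ future x u′ × (∀ α → w ∋ [Ag] α → x ∋ α)
    no-choice-between-undivided {w} {u} {u′} r s =
      let p , wp = named w in through p wp
      where
      undivided : u′ ∋ α → Not (w ∋ [Ag] ¬ F α)
      undivided h = ¬-elim
        (infer-at ⟦ w ⟧ F◇⇒AgF (◇-intro {w} {u} future r (◇-intro {u} {u′} now s h)))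

      through : ∀ p → w ∋ name p → ∃[ x ] Rᵏ future x u′ × (∀ α → w ∋ [Ag] α → x ∋ α)
      -- `x` is a point before `u′` with the name of `w`'s moment. If it refuted `α`, then
      -- `P (name p ∧ ¬ α)` at `u′` would contradict `[Ag] ¬ F P (name p ∧ ¬ α)` at `w`, which
      -- `alike` derives from `[Ag] α`.
      through p wp = x , R-converse past {u′} {x} u′x , λ α wα → stable λ x¬α →
        undivided (◇-intro {u′} {x} past u′x (∧-intro xp x¬α))
          (infer-at ⟦ w ⟧ (K grand) (infer-at ⟦ w ⟧ □⇒Ag (□-intro {w = w} now (alike α))) · wα)
        where
        -- Otherwise `u′` satisfies `H ¬ name p`, which no point later than a member of `w`'s moment
        -- does, since every such member satisfies `name p`.
        past-name : u′ ∋ P name p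
        past-name = ¬-intro λ h → undivided h (infer-at ⟦ w ⟧ □⇒Ag (□-intro {w = w} now λ x′ wx′ →
          ¬-intro λ f → let y , x′y , h′ = ◇-elim {x′} future f in
            ¬-elim (R-converse future {x′} {y} x′y _ h′) (name-moment {w} {x′} wp wx′)))

        found : ∃[ x ] Rᵏ past u′ x × x ∋ name p
        found = ◇-elim {u′} past past-name
        x = proj₁ found
        u′x = proj₁ (proj₂ found)
        xp = proj₂ (proj₂ found)

        -- Points before `y` are comparable, and `p`, false wherever `name p` holds, is true before
        -- and after `x′`; so `z` could only be `x′`.
        alike : ∀ α x′ → Rᵏ now w x′ → x′ ∋ α ⇒ ¬ F P (name p ∧ ¬ α)
        alike α x′ wx′ = ⇒-intro λ x′α → ¬-intro λ f →
          let y , x′y , h = ◇-elim {x′} future f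
              z , yz , zp¬α = ◇-elim {y} past h
          in conflict x′α zp¬α (backward-linear {y} {x′} {z} (R-converse future {x′} {y} x′y) yz)
          where
          x′p : x′ ∋ name p
          x′p = name-moment {w} {x′} wp wx′
          conflict : ∀ {z} → x′ ∋ α → z ∋ name p ∧ ¬ α → Not (Rᵏ future x′ z ⊎ x′ ≡ z ⊎ Rᵏ past x′ z)
          conflict {z} x′α h (inj₁ r)           = name-false {z} (∧-elimˡ h) (name-future {x′} {z} x′p r)
          conflict x′α h (inj₂ (inj₁ refl))     = ¬-elim (∧-elimʳ h) x′α
          conflict {z} x′α h (inj₂ (inj₂ r))    = name-false {z} (∧-elimˡ h) (name-past {x′} {z} x′p r)

    -- Settled formulas and characters

    Settled : Modality n → Form n → Set
    Settled m α = (⊢ α ⇒ modal m α) × (⊢ ¬ α ⇒ modal m (¬ α))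

    settled-S5 : ∀ {m} → IsS5 m → Settled m (modal m α)
    settled-S5 s = S5-4 s , S5-5 s

    settled-Ag : ∀ i → Settled grand ([ i ] α)
    settled-Ag i = ⇒-trans (S5-4 ([]-S5 i)) ([]⇒Ag i) , ⇒-trans (S5-5 ([]-S5 i)) ([]⇒Ag i)

    literal : World → Form n → Form n
    literal Γ α = if eval (val Γ) α then α else ¬ α

    literal-agree : ∀ Γ α → v ⊩ literal Γ α → eval (val Γ) α ≡ eval v α
    literal-agree Γ α h with eval (val Γ) α
    ... | true  = sym (value h)
    ... | false = sym (¬-not λ e → ¬-elim h (holds e))

    literal-settled : ∀ {m} Γ α → Settled m α → val Γ ⊩ modal m (literal Γ α)
    literal-settled Γ α (pos , neg) with eval (val Γ) α in eq
    ... | true  = infer-at Γ pos (holds eq)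
    ... | false = infer-at Γ neg (holds (cong not eq))

    character : List (Form n) → World → Form n
    character αs Γ = conj (map (literal Γ) αs)

    Agree : List (Form n) → Rel W 0ℓ
    Agree αs w u = ∀ α → α ∈ αs → eval (val ⟦ w ⟧) α ≡ eval (val ⟦ u ⟧) α

    Agree-equiv : ∀ αs → IsEquivalence (Agree αs)
    Agree-equiv αs = record
      { refl = λ _ _ → refl ; sym = λ f α i → sym (f α i) ; trans = λ f g α i → trans (f α i) (g α i) }

    agree : ∀ {αs w u} → Agree αs w u → α ∈ αs → w ∋ α → u ∋ α
    agree f i (holds e) = holds (trans (sym (f _ i)) e)

    character-agree : ∀ αs w u → u ∋ character αs ⟦ w ⟧ → Agree αs w u
    character-agree αs w u h α i = literal-agree ⟦ w ⟧ α
      (conj-elim (map (literal ⟦ w ⟧) αs) (∈-map⁺ (literal ⟦ w ⟧) i) h)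

    modal-conj : ∀ Γ m αs → (∀ {α} → α ∈ αs → val Γ ⊩ modal m α) → val Γ ⊩ modal m (conj αs)
    modal-conj Γ m = conj-closed (λ α → val Γ ⊩ modal m α) (theorems Γ (nec m (valid ⊤-true)))
      (modal-infer₂ Γ m ∧-intro)

    character-settled : ∀ {m} αs Γ → (∀ {α} → α ∈ αs → Settled m α) → val Γ ⊩ modal m (character αs Γ)
    character-settled {m} αs Γ settled = modal-conj Γ m (map (literal Γ) αs) at-literal
      where
      at-literal : β ∈ map (literal Γ) αs → val Γ ⊩ modal m β
      at-literal i with ∈-map⁻ (literal Γ) i
      ... | α , j , refl = literal-settled Γ α (settled j)

    -- Throughout the moment the character of `w` implies `β`; `□⇒m` puts this implication under
    -- `m`, and the character itself holds under `m` because the members of `αs` are settled.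
    agree-intro : ∀ m αs {w} → (∀ {α} → ⊢ □ α ⇒ modal m α) → (∀ {α} → α ∈ αs → Settled m α) →
                  (∀ u → Rᵏ now w u → Agree αs w u → u ∋ β) → w ∋ modal m β
    agree-intro m αs {w} □⇒m settled h =
      infer-at ⟦ w ⟧ (K m) (infer-at ⟦ w ⟧ □⇒m (□-intro {w = w} now λ u r →
        ⇒-intro λ c → h u r (character-agree αs w u c))) · character-settled αs ⟦ w ⟧ settled

    -- The axioms ioa and ⊗⇒◇[] impose only finitely many formulas at a time on a world;
    -- with canonical relations for [i] and ⊗ᵢ, C2 and D9 would need infinitely many at
    -- once, which saturation cannot provide.
    module Filtration (S : List (Form n)) where

      choices : Fin n → List (Form n)
      choices i = map (λ α → [ i ] α) S

      -- Including the choices of every agent makes C3 an inclusion of lists.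
      profile : List (Form n)
      profile = map (λ α → [Ag] α) S ++ concatMap choices (allFin n)

      choices⊆profile : ∀ i → α ∈ choices i → α ∈ profile
      choices⊆profile i j = ∈-++⁺ʳ (map (λ α → [Ag] α) S) (∈-concatMap⁺ choices (lose (∈-allFin i) j))

      choices-settled : ∀ i → α ∈ choices i → Settled (agent i) α
      choices-settled i j with ∈-map⁻ (λ α → [ i ] α) j
      ... | _ , _ , refl = settled-S5 ([]-S5 i)

      profile-settled : α ∈ profile → Settled grand α
      profile-settled j with ∈-++⁻ (map (λ α → [Ag] α) S) j
      ... | inj₁ k with ∈-map⁻ (λ α → [Ag] α) k
      ... | _ , _ , refl = settled-S5 Ag-S5
      profile-settled j | inj₂ k with find (∈-concatMap⁻ choices {xs = allFin n} k)
      ... | i , _ , l with ∈-map⁻ (λ α → [ i ] α) l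
      ... | _ , _ , refl = settled-Ag i

      R□∩ : List (Form n) → Rel W 0ℓ
      R□∩ αs w u = Rᵏ now w u × Agree αs w u

      R□∩-equiv : ∀ αs → IsEquivalence (R□∩ αs)
      R□∩-equiv αs = record
        { refl  = λ {w} → □.refl {w} , A.refl {w}
        ; sym   = λ {w} {u} (r , f) → □.sym {w} {u} r , A.sym {w} {u} f
        ; trans = λ {w} {u} {u′} (r , f) (s , g) → □.trans {w} {u} {u′} r s , A.trans {w} {u} {u′} f g
        }
        where module A = IsEquivalence (Agree-equiv αs)

      -- `R⊗ⁱ` asks for `[ i ] α` rather than `α`, so that it is closed under `Rⁱ i`; D9 and D11
      -- rest on this.
      Rⁱ R⊗ⁱ : Fin n → Rel W 0ℓ
      Rⁱ i = R□∩ (choices i)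
      R⊗ⁱ i w u = Rᵏ now w u × (∀ α → α ∈ S → w ∋ ⊗[ i ] α → u ∋ [ i ] α)

      Rᵍ : Rel W 0ℓ
      Rᵍ = R□∩ profile

      R⊗-closed : ∀ {i w u u′} → R⊗ⁱ i w u → Rⁱ i u u′ → R⊗ⁱ i w u′
      R⊗-closed {i} {w} {u} {u′} (r , f) (s , g) = □.trans {w} {u} {u′} r s ,
        λ α j h → agree {αs = choices i} {u} {u′} g (∈-map⁺ _ j) (f α j h)

      duties : Fin n → W → List (Form n)
      duties i w = filter (λ α → em {w ∋ ⊗[ i ] α}) S

      ⊗-duties : ∀ i w → w ∋ ⊗[ i ] conj (duties i w)
      ⊗-duties i w = modal-conj ⟦ w ⟧ (ought i) (duties i w) λ j →
        proj₂ (∈-filter⁻ (λ α → em {w ∋ ⊗[ i ] α}) {xs = S} j)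

      duties-elim : ∀ i w u → u ∋ [ i ] conj (duties i w) → ∀ α → α ∈ S → w ∋ ⊗[ i ] α → u ∋ [ i ] α
      duties-elim i w u h α j p = infer-at ⟦ u ⟧ (modal-mono (agent i) (valid (⇒-intro
        (conj-elim (duties i w) (∈-filter⁺ (λ α → em {w ∋ ⊗[ i ] α}) j p))))) h

      ⊗-serial : ∀ i w → ∃[ u ] R⊗ⁱ i w u
      ⊗-serial i w =
        let u , r , h = ◇-elim {w} now (infer-at ⟦ w ⟧ ⊗⇒◇[] (⊗-duties i w))
        in u , r , duties-elim i w u h

      ⊗-constant : ∀ i {w u} → Rᵏ now w u → u ∋ ⊗[ i ] α → w ∋ ⊗[ i ] α
      ⊗-constant i {w} {u} r h =
        infer-at ⟦ w ⟧ T-□ (infer-at ⟦ w ⟧ ◇⊗⇒□⊗ (◇-intro {w} {u} now r h))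

      -- A world of the moment where `[ i ]` of the duties holds is an `R⊗ⁱ`-successor, as is its
      -- whole `Rⁱ`-class, so it satisfies `[ i ] α`; `⊗-mono` then passes from the duties to `α`.
      ⊗-intro : ∀ i {w} → (∀ u → R⊗ⁱ i w u → u ∋ α) → w ∋ ⊗[ i ] α
      ⊗-intro {α} i {w} h =
        infer-at ⟦ w ⟧ ⊗-mono (□-intro {w = w} now λ u r → ⇒-intro (settle u r)) · ⊗-duties i w
        where
        settle : ∀ u → Rᵏ now w u → u ∋ [ i ] conj (duties i w) → u ∋ [ i ] α
        settle u r p = agree-intro (agent i) (choices i) {u} □⇒[] (choices-settled i) λ u′ s f →
          h u′ (R⊗-closed {i} {w} {u} {u′} (r , duties-elim i w u p) (s , f))

      -- `ioa` at the characters of the `u i`: a world where all the `chosen i` hold agrees with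
      -- each `u i` on the choices of `i`.
      independent : (u : Fin n → W) → (∀ i j → Rᵏ now (u i) (u j)) → ∃[ w ] ∀ i → Rⁱ i (u i) w
      independent u r = x , λ i → □.trans {u i} {u i₀} {x} (r i i₀) u₀x ,
        character-agree (choices i) (u i) x (infer-at ⟦ x ⟧ T-[] (⋀-elim chosen i h))
        where
        chosen : Fin n → Form n
        chosen i = [ i ] character (choices i) ⟦ u i ⟧
        possible : u i₀ ∋ ◇ ⋀ chosen
        possible = infer-at ⟦ u i₀ ⟧ ioa (⋀-intro (λ i → ◇ chosen i) λ i →
          ◇-intro {u i₀} {u i} now (r i₀ i) (character-settled (choices i) ⟦ u i ⟧ (choices-settled i)))
        found : ∃[ w ] Rᵏ now (u i₀) w × w ∋ ⋀ chosen
        found = ◇-elim {u i₀} now possible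
        x = proj₁ found
        u₀x = proj₁ (proj₂ found)
        h = proj₂ (proj₂ found)

      -- `x` satisfies whatever is `[Ag]`-necessary at `w`: all that is `□`-necessary there, and the
      -- character of `profile`.
      undivided-profile : ∀ {w u u′} → Rᵏ future w u → Rᵏ now u u′ → ∃[ x ] Rᵍ w x × Rᵏ future x u′
      undivided-profile {w} {u} {u′} r s =
        let x , xu′ , f = no-choice-between-undivided {w} {u} {u′} r s
        in x , ((λ α h → f α (infer-at ⟦ w ⟧ □⇒Ag h)) ,
                character-agree profile w x (f _ (character-settled profile ⟦ w ⟧ profile-settled))) , xu′

      frame : Frame n
      frame = record
        { W        = W
        ; nonempty = class root
        ; R□       = Rᵏ now
        ; R[_]     = Rⁱ
        ; RAg      = Rᵍ
        ; RG       = Rᵏ future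
        ; RH       = Rᵏ past
        ; R⊗[_]    = R⊗ⁱ
        ; □-equiv  = R□-equiv
        ; []-equiv = λ i → R□∩-equiv (choices i)
        ; Ag-equiv = R□∩-equiv profile
        ; C1       = proj₁
        ; C2       = independent
        ; C3       = λ (r , f) i → r , λ α j → f α (choices⊆profile i j)
        ; G-trans  = λ {w} {u} {u′} → R-trans future 4-G {w} {u} {u′}
        ; G-serial = λ w → let u , r , _ = ◇-elim {w} {⊤} future (theorems ⟦ w ⟧ (mp D-G (nec-G (valid ⊤-true))))
                             in u , r
        ; H-conv   = λ {w} {u} → mk⇔ (R-converse past {w} {u}) (R-converse future {u} {w})
        ; T4       = λ {w} {u} {u′} r s → Sum.map₂ (Sum.map₂ (R-converse past {u} {u′}))
                       (forward-linear {w} {u} {u′} r s)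
        ; T5       = λ {w} {u} {u′} r s → reverse {u} {u′} (backward-linear {w} {u} {u′} r s)
        ; T6       = λ {w} {u} {u′} → undivided-profile {w} {u} {u′}
        ; T7       = λ {w} {u} → irreflexive {w} {u}
        ; D8       = proj₁
        ; D9       = λ i w → let u , r , f = ⊗-serial i w in
                       u , r , λ u′ → R⊗-closed {i} {w} {u} {u′} (r , f)
        ; D10      = λ {i} {w} {u} {u′} {x} r s (q , f) →
                       let uu′ = □.trans {u} {w} {u′} (□.sym {w} {u} r) s in
                       □.trans {u} {u′} {x} uu′ q ,
                       λ α j h → f α j (⊗-constant i {u′} {u} (□.sym {u} {u′} uu′) h)
        ; D11      = λ {i} {w} {u} (r , f) → u , r , IsEquivalence.refl (R□∩-equiv (choices i)) {u} ,
                       λ u′ → R⊗-closed {i} {w} {u} {u′} (r , f)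
        }
        where
        reverse : ∀ {w u} → Rᵏ future w u ⊎ w ≡ u ⊎ Rᵏ past w u → Rᵏ past w u ⊎ w ≡ u ⊎ Rᵏ past u w
        reverse {w} {u} (inj₁ r)        = inj₂ (inj₂ (R-converse future {w} {u} r))
        reverse         (inj₂ (inj₁ e)) = inj₂ (inj₁ e)
        reverse         (inj₂ (inj₂ r)) = inj₁ r

      model : Model n
      model = record { frame = frame ; V = λ p w → w ∋ var p }

      -- Truth lemma

      R : Modality n → Rel W 0ℓ
      R = Frame.R frame

      -- The filtered relations transfer `modal m α` only for `α` in `S`, hence the membership
      -- hypothesis.
      modal-elim : ∀ m {w u} → α ∈ S → w ∋ modal m α → R m w u → u ∋ α
      modal-elim box       i h r = r _ h
      modal-elim (agent j) {w} {u} i h (r , f) =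
        infer-at ⟦ u ⟧ T-[] (agree {αs = choices j} {w} {u} f (∈-map⁺ _ i) h)
      modal-elim grand     {w} {u} i h (r , f) =
        infer-at ⟦ u ⟧ T-Ag (agree {αs = profile} {w} {u} f (∈-++⁺ˡ (∈-map⁺ _ i)) h)
      modal-elim always    i h r = r _ h
      modal-elim hasAlways i h r = r _ h
      modal-elim (ought j) {w} {u} i h (r , f) = infer-at ⟦ u ⟧ T-[] (f _ i h)

      modal-intro : ∀ m {w} → (∀ u → R m w u → u ∋ α) → w ∋ modal m α
      modal-intro box       {w} = □-intro {w = w} now
      modal-intro (agent j) {w} h = agree-intro (agent j) (choices j) {w} □⇒[] (choices-settled j)
        λ u r f → h u (r , f)
      modal-intro grand     {w} h = agree-intro grand profile {w} □⇒Ag profile-settled λ u r f → h u (r , f)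
      modal-intro always    {w} = □-intro {w = w} future
      modal-intro hasAlways {w} = □-intro {w = w} past
      modal-intro (ought j) {w} = ⊗-intro j {w}

      truth-⇒ : ∀ α → (∀ {β} → β ∈ subformulas α → β ∈ S) → ∀ w → model , w ⊨ α → w ∋ α
      truth-⇐ : ∀ α → (∀ {β} → β ∈ subformulas α → β ∈ S) → ∀ w → w ∋ α → model , w ⊨ α
      truth-⇒ (var p)     s w h = h
      truth-⇒ (¬ α)       s w h = ¬-intro λ p → h (truth-⇐ α (s ∘ there) w p)
      truth-⇒ (α ∧ β)     s w (p , q) = ∧-intro
        (truth-⇒ α (s ∘ there ∘ ∈-++⁺ˡ) w p) (truth-⇒ β (s ∘ there ∘ ∈-++⁺ʳ (subformulas α)) w q)
      truth-⇒ (modal m α) s w h = modal-intro m {w} λ u r → truth-⇒ α (s ∘ there) u (h u r)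
      truth-⇐ (var p)     s w h = h
      truth-⇐ (¬ α)       s w h p = ¬-elim h (truth-⇒ α (s ∘ there) w p)
      truth-⇐ (α ∧ β)     s w h =
        truth-⇐ α (s ∘ there ∘ ∈-++⁺ˡ) w (∧-elimˡ h) , truth-⇐ β (s ∘ there ∘ ∈-++⁺ʳ (subformulas α)) w (∧-elimʳ h)
      truth-⇐ (modal m α) s w h u r =
        truth-⇐ α (s ∘ there) u (modal-elim m {w} {u} (s (there (self∈subformulas α))) h r)

  satisfy : Not (⊢ ¬ α) → Satisfiable α
  satisfy {α} con = model , class root ,
    truth-⇐ α (λ i → i) (class root) (rep-≈ root α (Lindenbaum.α₀∈world root-consistency α con))
    where
    open Canonical (Lindenbaum.world root-consistency α con)
    open Filtration (subformulas α)

theorem2 : ExcludedMiddle 0ℓ →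
    ∀ (n : ℕ) .{{_ : NonZero n}} (φ : Form n) → Consistent φ → Satisfiable φ
-- A proof of `¬ φ` would derive `⊥` from the list `φ ∷ []`. `NonZero n` leaves the case `suc n`,
-- where `zero` is an agent.
theorem2 em (suc n) φ con = Completeness.satisfy em zero λ d →
  con (inj₂ (φ ∷ [] , refl ∷ [] , infer (λ p → ⇒-intro λ q → ⊥-elim (¬-elim p q)) d))
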